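{- Let $n\ge 5$ and $2\le k<n$. Then $\operatorname{Dist}(\mathrm{PX}(n,k))=2$ and $\lceil n/k\rceil\le \rho(\mathrm{PX}(n,k))\le \lceil n/k\rceil+1$.
   Context: For integers $n\ge 3$ and $1\le k<n$, the Praeger–Xu graph $\mathrm{PX}(n,k)$ is the simple graph with vertex set $\mathbb Z_n\times\mathbb Z_2^k$; a vertex is written $(i,x)$ with $x=x_0x_1\cdots x_{k-1}$ a bitstring of length $k$. Two vertices $(i,x)$ and $(j,y)$ are adjacent if and only if (after possibly swapping the two vertices) $j=i+1$ in $\mathbb Z_n$ and $x=az_1\cdots z_{k-1}$, $y=z_1\cdots z_{k-1}b$ for some bits $a,b,z_1,\dots,z_{k-1}\in\mathbb Z_2$. For a graph $G$, $\operatorname{Dist}(G)$ is the least $d$ such that some $d$-coloring of the vertices is preserved (class-wise) only by the identity automorphism; if $\operatorname{Dist}(G)=2$, $\rho(G)$ is the minimum size of a color class over all 2-colorings preserved only by the identity automorphism. -}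

module Defs where

open import Data.Nat using (ℕ; zero; suc; _+_; _<_; _≤_)
open import Data.Nat.DivMod using (_/_)
open import Data.Fin using (Fin; toℕ)
open import Data.Fin.Properties using (_≟_)
open import Data.Bool using (Bool; true; false)
open import Data.Vec using (Vec; []; _∷_; _∷ʳ_)
open import Data.List using (List; []; _∷_; map; _++_; allFin; cartesianProduct; length; filter)
open import Data.Product using (Σ; ∃; _×_; _,_)
open import Data.Sum using (_⊎_)
open import Relation.Binary.PropositionalEquality using (_≡_)
open import Relation.Nullary using (¬_)

Vertex : ℕ → ℕ → Set
Vertex n k = Fin n × Vec Bool k

IsSucc : {n : ℕ} → Fin n → Fin n → Set
IsSucc {n} i j = (suc (toℕ i) ≡ toℕ j) ⊎ (suc (toℕ i) ≡ n × toℕ j ≡ 0)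

Shift : {k : ℕ} → Vec Bool k → Vec Bool k → Set
Shift {zero} x y = Bool × Bool     -- k = 0 never used (k ≥ 1); any a, b work
Shift {suc m} x y = Σ Bool λ a → Σ Bool λ b → Σ (Vec Bool m) λ z →
  (x ≡ a ∷ z) × (y ≡ z ∷ʳ b)

Arc : (n k : ℕ) → Vertex n k → Vertex n k → Set
Arc n k (i , x) (j , y) = IsSucc i j × Shift x y

Adj : (n k : ℕ) → Vertex n k → Vertex n k → Set
Adj n k u v = Arc n k u v ⊎ Arc n k v u

record Automorphism (n k : ℕ) : Set where
  field
    to      : Vertex n k → Vertex n k
    from    : Vertex n k → Vertex n k
    to-from : ∀ v → to (from v) ≡ v
    from-to : ∀ v → from (to v) ≡ v
    adj→    : ∀ u v → Adj n k u v → Adj n k (to u) (to v)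
    adj←    : ∀ u v → Adj n k (to u) (to v) → Adj n k u v

Distinguishing : (n k d : ℕ) → (Vertex n k → Fin d) → Set
Distinguishing n k d c =
  (σ : Automorphism n k) → (∀ v → c (Automorphism.to σ v) ≡ c v) →
  ∀ v → Automorphism.to σ v ≡ v

HasDistColoring : (n k d : ℕ) → Set
HasDistColoring n k d = Σ (Vertex n k → Fin d) λ c → Distinguishing n k d c

DistIs : (n k d : ℕ) → Set
DistIs n k d = HasDistColoring n k d × (∀ d′ → d′ < d → ¬ HasDistColoring n k d′)

allVecs : (k : ℕ) → List (Vec Bool k)
allVecs zero = [] ∷ []
allVecs (suc k) = map (true ∷_) (allVecs k) ++ map (false ∷_) (allVecs k)

allVertices : (n k : ℕ) → List (Vertex n k)
allVertices n k = cartesianProduct (allFin n) (allVecs k)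

classSize : (n k d : ℕ) → (Vertex n k → Fin d) → Fin d → ℕ
classSize n k d c i = length (filter (λ v → c v ≟ i) (allVertices n k))

RhoIs : (n k r : ℕ) → Set
RhoIs n k r =
  (Σ (Vertex n k → Fin 2) λ c → Distinguishing n k 2 c × Σ (Fin 2) λ i → classSize n k 2 c i ≡ r)
  × (∀ (c : Vertex n k → Fin 2) → Distinguishing n k 2 c → ∀ i → r ≤ classSize n k 2 c i)

-- ⌈ n / k ⌉ for k ≥ 1 (junk value 0 for k = 0)
ceilDiv : ℕ → ℕ → ℕ
ceilDiv n zero = 0
ceilDiv n (suc k) = (n + k) / suc k

{-# OPTIONS --safe #-}

-- Bit j of the vertex (i , x) sits at position i + j of the cycle ℤₙ, and flipping the bit at a
-- fixed position in all vertices is an automorphism.  A colour class with fewer than n/k vertices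
-- misses some position in all its windows, so the flip there preserves the colouring: this is the
-- lower bound.
--
-- For n ≥ 5 and k ≥ 2 a 4-cycle never passes through three consecutive levels, so an automorphism
-- preserves all arcs or reverses all arcs, and it permutes levels.  If it preserves arcs and fixes
-- vertices whose windows cover ℤₙ, then it is the identity: the first bit of the image of a vertex
-- depends only on the level and the first bit of the vertex, and every bit becomes a first bit
-- further along a walk.  With q = ⌈n/k⌉ − 1, vertices on the levels k, 2k, …, qk together with
-- two more vertices cover ℤₙ.  If k ∤ n, the two are twins on level 0, differing in the first bit only;
-- if k ∣ n, they span the only edge within the class.
--
-- Which of the two values ρ takes is decided by exhaustive search.
module Submission where

open import Defs
open import Data.Bool using (Bool; true; false; not; if_then_else_) renaming (_≟_ to _≟ᵇ_)
open import Data.Bool.Properties using (not-¬; ¬-not; not-involutive)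
open import Data.Empty using (⊥; ⊥-elim)
open import Data.Fin using (Fin; zero; suc; toℕ; fromℕ; fromℕ<; inject₁)
open import Data.Fin.Properties using (any?; injective⇒≤; toℕ-injective; toℕ<n; toℕ-fromℕ; toℕ-fromℕ<; toℕ-inject₁)
  renaming (_≟_ to _≟ᶠ_)
open import Data.List using (List; []; _∷_; length; lookup; map; filter; allFin; upTo; applyUpTo; cartesianProductWith)
open import Data.List.Membership.Propositional using (_∈_; find; lose)
open import Data.List.Membership.Propositional.Properties
open import Data.List.Membership.Setoid.Properties using (index-injective)
open import Data.List.Properties using (length-++; length-map; length-applyUpTo; length-tabulate; filter-≐)
open import Data.List.Relation.Unary.All as All using ()
open import Data.List.Relation.Unary.AllPairs using ([]; _∷_)
open import Data.List.Relation.Unary.Any as Any using (here; there)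
open import Data.List.Relation.Unary.Any.Properties using (lookup-index)
open import Data.List.Relation.Unary.Unique.Propositional using (Unique)
open import Data.List.Relation.Unary.Unique.Propositional.Properties using (map⁺; ++⁺; cartesianProduct⁺; allFin⁺; filter⁺)
open import Data.Nat using (ℕ; zero; suc; _+_; _*_; _∸_; _≤_; _<_; z≤n; s≤s; s≤s⁻¹; _<?_)
open import Data.Nat.DivMod using (_/_; _%_; m≡m%n+[m/n]*n; m%n<n; m/n*n≤m; m/n≡1+[m∸n]/n)
open import Data.Nat.Properties
open import Data.Product using (Σ; ∃; ∃₂; _×_; _,_; proj₁; proj₂)
open import Data.Product.Properties using () renaming (≡-dec to ×-≡-dec)
open import Data.Sum using (_⊎_; inj₁; inj₂; [_,_]′)
open import Data.Vec as Vec using (Vec; []; _∷_; _∷ʳ_; init; initLast; replicate)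
open import Data.Vec.Properties using (lookup∘tabulate; ∷-injectiveʳ) renaming (≡-dec to Vec-≡-dec)
open import Function using (_∘_)
open import Relation.Binary.PropositionalEquality
open import Relation.Nullary using (¬_; Dec; yes; no; does; contradiction)
open import Relation.Nullary.Decidable using (map′; ¬?; _×-dec_; _⊎-dec_; _→-dec_; decidable-stable; dec-true; dec-false)
open import Relation.Unary using (Decidable)

-- Bits of a string

-- Total indexing: the value past the end is the junk value false.
nth : ∀ {m} → ℕ → Vec Bool m → Bool
nth _       []      = false
nth zero    (b ∷ _) = b
nth (suc j) (_ ∷ x) = nth j x

nth-ext : ∀ {m} {x y : Vec Bool m} → (∀ j → j < m → nth j x ≡ nth j y) → x ≡ y
nth-ext {x = []}    {[]}    _ = refl
nth-ext {x = _ ∷ _} {_ ∷ _} h =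
  cong₂ _∷_ (h 0 (s≤s z≤n)) (nth-ext (λ j j<m → h (suc j) (s≤s j<m)))

nth-∷ʳ : ∀ {m} j (x : Vec Bool m) b → j < m → nth j (x ∷ʳ b) ≡ nth j x
nth-∷ʳ zero    (_ ∷ _) b _         = refl
nth-∷ʳ (suc j) (_ ∷ x) b (s≤s j<m) = nth-∷ʳ j x b j<m

nth-init : ∀ {m} j (x : Vec Bool (suc m)) → j < m → nth j (init x) ≡ nth j x
nth-init j x j<m with initLast x
... | y , b , refl = sym (nth-∷ʳ j y b j<m)

nth-replicate : ∀ {m} j b → j < m → nth j (replicate m b) ≡ b
nth-replicate zero    b (s≤s _)   = refl
nth-replicate (suc j) b (s≤s j<m) = nth-replicate j b j<m

toggle : ∀ {m} → ℕ → Vec Bool m → Vec Bool m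
toggle _       []      = []
toggle zero    (b ∷ x) = not b ∷ x
toggle (suc j) (b ∷ x) = b ∷ toggle j x

nth-toggle : ∀ {m} j (x : Vec Bool m) → j < m → nth j (toggle j x) ≡ not (nth j x)
nth-toggle zero    (_ ∷ _) _         = refl
nth-toggle (suc j) (_ ∷ x) (s≤s j<m) = nth-toggle j x j<m

nth-toggle-≢ : ∀ {m} i j (x : Vec Bool m) → i ≢ j → nth i (toggle j x) ≡ nth i x
nth-toggle-≢ i       j       []      _   = refl
nth-toggle-≢ zero    zero    (_ ∷ _) i≢j = contradiction refl i≢j
nth-toggle-≢ zero    (suc j) (_ ∷ _) _   = refl
nth-toggle-≢ (suc i) zero    (_ ∷ _) _   = refl
nth-toggle-≢ (suc i) (suc j) (_ ∷ x) i≢j = nth-toggle-≢ i j x (i≢j ∘ cong suc)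

toggle-≢ : ∀ {m} j (x : Vec Bool m) → j < m → toggle j x ≢ x
toggle-≢ j x j<m eq = not-¬ refl (trans (sym (cong (nth j) eq)) (nth-toggle j x j<m))

-- Arithmetic on the cycle of levels

module _ {N : ℕ} where

  IsSucc-unique : {i j j′ : Fin (suc N)} → IsSucc i j → IsSucc i j′ → j ≡ j′
  IsSucc-unique (inj₁ a)       (inj₁ b)       = toℕ-injective (trans (sym a) b)
  IsSucc-unique {j = j} (inj₁ a) (inj₂ (b , _)) =
    contradiction (trans (sym a) b) (<⇒≢ (toℕ<n j))
  IsSucc-unique {j′ = j} (inj₂ (b , _)) (inj₁ a) =
    contradiction (trans (sym a) b) (<⇒≢ (toℕ<n j))
  IsSucc-unique (inj₂ (_ , a)) (inj₂ (_ , b)) = toℕ-injective (trans a (sym b))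

  IsSucc-injective : {i i′ j : Fin (suc N)} → IsSucc i j → IsSucc i′ j → i ≡ i′
  IsSucc-injective (inj₁ a) (inj₁ b) = toℕ-injective (suc-injective (trans a (sym b)))
  IsSucc-injective (inj₁ a) (inj₂ (_ , b)) = contradiction (trans a b) 1+n≢0
  IsSucc-injective (inj₂ (_ , b)) (inj₁ a) = contradiction (trans a b) 1+n≢0
  IsSucc-injective (inj₂ (a , _)) (inj₂ (b , _)) =
    toℕ-injective (suc-injective (trans a (sym b)))

  next : Fin (suc N) → Fin (suc N)
  next i with suc (toℕ i) <? suc N
  ... | yes p = fromℕ< p
  ... | no _  = zero

  next-IsSucc : ∀ i → IsSucc i (next i)
  next-IsSucc i with suc (toℕ i) <? suc N
  ... | yes p = inj₁ (sym (toℕ-fromℕ< p))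
  ... | no ¬p = inj₂ (≤-antisym (toℕ<n i) (≮⇒≥ ¬p) , refl)

  next-injective : ∀ {i j} → next i ≡ next j → i ≡ j
  next-injective {i} {j} eq =
    IsSucc-injective (subst (IsSucc i) eq (next-IsSucc i)) (next-IsSucc j)

  prev : ∀ i → ∃ λ j → next j ≡ i
  prev zero    = fromℕ N , IsSucc-unique (next-IsSucc _) (inj₂ (cong suc (toℕ-fromℕ N) , refl))
  prev (suc i) = inject₁ i , IsSucc-unique (next-IsSucc _) (inj₁ (cong suc (toℕ-inject₁ i)))

  infixl 7 _↑_
  _↑_ : Fin (suc N) → ℕ → Fin (suc N)
  i ↑ zero  = i
  i ↑ suc d = next (i ↑ d)

  ↑-+ : ∀ i a b → i ↑ (a + b) ≡ i ↑ b ↑ a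
  ↑-+ i zero    b = refl
  ↑-+ i (suc a) b = cong next (↑-+ i a b)

  next-↑ : ∀ i d → next i ↑ d ≡ next (i ↑ d)
  next-↑ i zero    = refl
  next-↑ i (suc d) = cong next (next-↑ i d)

  ↑-injective : ∀ d {i j} → i ↑ d ≡ j ↑ d → i ≡ j
  ↑-injective zero    eq = eq
  ↑-injective (suc d) eq = ↑-injective d (next-injective eq)

  ↑-surjective : ∀ d i → ∃ λ j → j ↑ d ≡ i
  ↑-surjective zero    i = i , refl
  ↑-surjective (suc d) i with prev i
  ... | j , refl with ↑-surjective d j
  ...   | l , refl = l , refl

  toℕ-↑ : ∀ {t} → t < suc N → toℕ (zero ↑ t) ≡ t
  toℕ-↑ {zero}  _ = refl
  toℕ-↑ {suc t} t<N with next-IsSucc (zero ↑ t) | toℕ-↑ (<-trans (n<1+n t) t<N)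
  ... | inj₁ a       | ih = trans (sym a) (cong suc ih)
  ... | inj₂ (b , _) | ih = contradiction (trans (cong suc (sym ih)) b) (<⇒≢ t<N)

  zero↑toℕ : ∀ i → zero ↑ toℕ i ≡ i
  zero↑toℕ i = toℕ-injective (toℕ-↑ (toℕ<n i))

  ↑-wrap : zero ↑ suc N ≡ zero
  ↑-wrap with next-IsSucc (zero ↑ N)
  ... | inj₁ a       = contradiction (trans (cong suc (sym (toℕ-↑ (n<1+n N)))) a)
    (<⇒≢ (toℕ<n (next (zero ↑ N))) ∘ sym)
  ... | inj₂ (_ , c) = toℕ-injective c

  -- With `i` written as `zero ↑ t`, the shifts by `d` and by `t` commute. Cancelling `t` moves the
  -- equation to level 0, where `toℕ-↑` reads off `d`.
  ↑-free : ∀ i {d} → d < suc N → i ↑ d ≡ i → d ≡ 0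
  ↑-free i {d} d<n eq = trans (sym (toℕ-↑ d<n)) (cong toℕ (↑-injective t shifted))
    where
    t = toℕ i
    shifted : zero ↑ d ↑ t ≡ zero ↑ t
    shifted = begin
      zero ↑ d ↑ t     ≡⟨ ↑-+ zero t d ⟨
      zero ↑ (t + d)   ≡⟨ cong (zero ↑_) (+-comm t d) ⟩
      zero ↑ (d + t)   ≡⟨ ↑-+ zero d t ⟩
      zero ↑ t ↑ d     ≡⟨ cong (_↑ d) (zero↑toℕ i) ⟩
      i ↑ d            ≡⟨ eq ⟩
      i                ≡⟨ zero↑toℕ i ⟨
      zero ↑ t         ∎
      where open ≡-Reasoning

  ↑-connected : ∀ i j → ∃ λ d → i ↑ d ≡ j
  -- The first `suc N ∸ toℕ i` steps lead round to `zero`, the other `toℕ j` from there to `j`.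
  ↑-connected i j = toℕ j + (suc N ∸ toℕ i) , (begin
      i ↑ (toℕ j + (suc N ∸ toℕ i))             ≡⟨ ↑-+ i (toℕ j) _ ⟩
      i ↑ (suc N ∸ toℕ i) ↑ toℕ j               ≡⟨ cong (λ l → l ↑ (suc N ∸ toℕ i) ↑ toℕ j) (zero↑toℕ i) ⟨
      zero ↑ toℕ i ↑ (suc N ∸ toℕ i) ↑ toℕ j    ≡⟨ cong (_↑ toℕ j) (↑-+ zero (suc N ∸ toℕ i) (toℕ i)) ⟨
      zero ↑ (suc N ∸ toℕ i + toℕ i) ↑ toℕ j    ≡⟨ cong (λ d → zero ↑ d ↑ toℕ j) (m∸n+n≡m (<⇒≤ (toℕ<n i))) ⟩
      zero ↑ suc N ↑ toℕ j                      ≡⟨ cong (_↑ toℕ j) ↑-wrap ⟩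
      zero ↑ toℕ j                              ≡⟨ zero↑toℕ j ⟩
      j                                         ∎)
    where open ≡-Reasoning

  ↑-connected-≥ : ∀ D i j → ∃ λ d → D ≤ d × i ↑ d ≡ j
  ↑-connected-≥ D i j with ↑-connected (i ↑ D) j
  ... | e , eq = e + D , m≤n+m D e , trans (↑-+ i e D) eq

-- Arcs and directed paths

module PX (N K : ℕ) where

  V : Set
  V = Vertex (suc N) (suc K)

  level : V → Fin (suc N)
  level = proj₁

  bit : ℕ → V → Bool
  bit j v = nth j (proj₂ v)

  -- The oriented adjacency with n = `suc N` and k = `suc K`. Equations between single bits replace
  -- the existential splitting in `Arc`, so they chain along a path by transitivity.
  record _⟶_ (u v : V) : Set where
    constructor arc
    field
      level-next : level v ≡ next (level u)
      bit-shift  : ∀ j → j < K → bit (suc j) u ≡ bit j v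
  open _⟶_ public

  fromArc : ∀ {u v} → Arc (suc N) (suc K) u v → u ⟶ v
  fromArc {u} (s , a , b , z , refl , refl) =
    arc (IsSucc-unique s (next-IsSucc (level u))) (λ j j<K → sym (nth-∷ʳ j z b j<K))

  toArc : ∀ {u v} → u ⟶ v → Arc (suc N) (suc K) u v
  toArc {u@(i , a ∷ z)} {v@(j , y)} (arc l s) with initLast y
  ... | y′ , b , refl =
    subst (IsSucc i) (sym l) (next-IsSucc i) , a , b , z , refl ,
    cong (_∷ʳ b) (nth-ext (λ j j<K → sym (trans (s j j<K) (nth-∷ʳ j y′ b j<K))))

  infix 4 _~_
  _~_ : V → V → Set
  u ~ v = u ⟶ v ⊎ v ⟶ u

  vertex-ext : ∀ {u v : V} → level u ≡ level v → (∀ j → j < suc K → bit j u ≡ bit j v) → u ≡ v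
  vertex-ext refl bits = cong (_ ,_) (nth-ext bits)

  flipBit : ℕ → V → V
  flipBit j (i , x) = i , toggle j x

  flipBit-≢ : ∀ {j} → j < suc K → ∀ v → flipBit j v ≢ v
  flipBit-≢ {j} j<k (_ , x) eq = toggle-≢ j x j<k (cong proj₂ eq)

  -- An arc drops the first bit of its tail and introduces the last bit of its head, so neither is
  -- constrained. This provides every vertex with a twin sharing its out-neighbours and one sharing
  -- its in-neighbours.
  flip-head-⟶ : ∀ {u v} → u ⟶ v → flipBit 0 u ⟶ v
  flip-head-⟶ {u} (arc l s) = arc l λ j j<K →
    trans (nth-toggle-≢ (suc j) 0 (proj₂ u) λ ()) (s j j<K)

  flip-last-⟶ : ∀ {u v} → u ⟶ v → u ⟶ flipBit K v
  flip-last-⟶ {v = v} (arc l s) = arc l λ j j<K →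
    trans (s j j<K) (sym (nth-toggle-≢ j K (proj₂ v) (<⇒≢ j<K)))

  -- The head of an arc determines the level of the tail and all its bits except the first.
  same-targets : ∀ {u u′ w} → u ⟶ w → u′ ⟶ w → bit 0 u ≡ bit 0 u′ → u ≡ u′
  same-targets {u} {u′} (arc l s) (arc l′ s′) head =
    vertex-ext {u} {u′} (next-injective (trans (sym l) l′)) λ where
    zero    _           → head
    (suc j) (s≤s j<K) → trans (s j j<K) (sym (s′ j j<K))

  data Path : ℕ → V → V → Set where
    []  : ∀ {u} → Path 0 u u
    _▷_ : ∀ {d u v w} → Path d u v → v ⟶ w → Path (suc d) u w

  _◁_ : ∀ {d u v w} → u ⟶ v → Path d v w → Path (suc d) u w
  a ◁ []      = [] ▷ a
  a ◁ (p ▷ b) = (a ◁ p) ▷ b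

  path-level : ∀ {d u v} → Path d u v → level v ≡ level u ↑ d
  path-level []      = refl
  path-level (p ▷ a) = trans (level-next a) (cong next (path-level p))

  -- Each arc moves a surviving bit one place towards the front.
  path-bit : ∀ {d u v} → Path d u v → ∀ j → j + d < suc K → bit (j + d) u ≡ bit j v
  path-bit {u = u} [] j _ = cong (λ i → bit i u) (+-identityʳ j)
  path-bit {suc d} {u} (p ▷ a) j lt =
    trans (cong (λ i → bit i u) (+-suc j d))
      (trans (path-bit p (suc j) lt′) (bit-shift a j (s≤s⁻¹ (≤-<-trans (m≤m+n (suc j) d) lt′))))
    where
    lt′ : suc j + d < suc K
    lt′ = subst (_< suc K) (+-suc j d) lt

  path-head : ∀ {d u v} → Path d u v → d < suc K → bit d u ≡ bit 0 v
  path-head p = path-bit p 0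

  -- The only obstruction to a path of given length is disagreement on the overlap of the two
  -- windows; all later bits are free choices along the way.
  connect : ∀ d u y → (∀ j → j + d < suc K → bit (j + d) u ≡ nth j y) →
            Path d u (level u ↑ d , y)
  connect zero u y h =
    subst (Path 0 u) (vertex-ext {u} refl λ j lt → trans (cong (λ i → bit i u) (sym (+-identityʳ j)))
      (h j (subst (_< suc K) (sym (+-identityʳ j)) lt))) []
  connect (suc d) u y h = connect d u y′ h′ ▷ arc refl (λ j j<K → nth-init j y j<K)
    where
    y′ : Vec Bool (suc K)
    -- The last vertex but one has to begin with the bit of `u` at its own position. For `d` beyond
    -- `K` this is the junk value of `nth`, harmless because the overlap is then empty.
    y′ = bit d u ∷ init y
    h′ : ∀ j → j + d < suc K → bit (j + d) u ≡ nth j y′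
    h′ zero    _  = refl
    h′ (suc j) lt = trans (cong (λ i → bit i u) (sym (+-suc j d)))
      (trans (h j (subst (_< suc K) (sym (+-suc j d)) lt))
             (sym (nth-init j y (s≤s⁻¹ (≤-<-trans (m≤m+n (suc j) d) lt)))))

  connect-far : ∀ d u y → K < d → Path d u (level u ↑ d , y)
  connect-far d u y K<d = connect d u y λ j lt →
    contradiction (≤-trans lt (≤-trans K<d (m≤n+m d j))) (<-irrefl refl)

  strongly-connected : ∀ u v → ∃ λ d → Path d u v
  -- A length above `K` leaves none of the old bits in the window, so every string can be reached.
  strongly-connected u (i , y) with ↑-connected-≥ (suc K) (level u) i
  ... | d , K<d , refl = d , connect-far d u y K<d

  successor : ∀ u → ∃ λ v → u ⟶ v
  successor (i , _ ∷ z) = (next i , z ∷ʳ false) , arc refl (λ j j<K → sym (nth-∷ʳ j z false j<K))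

  advance : ∀ d u → ∃ λ v → Path d u v
  advance zero    u = u , []
  advance (suc d) u with advance d u
  ... | v , p with successor v
  ...   | w , a = w , p ▷ a

  ~⇒Adj : ∀ {u v} → u ~ v → Adj (suc N) (suc K) u v
  ~⇒Adj = [ inj₁ ∘ toArc , inj₂ ∘ toArc ]′

  Adj⇒~ : ∀ {u v} → Adj (suc N) (suc K) u v → u ~ v
  Adj⇒~ = [ inj₁ ∘ fromArc , inj₂ ∘ fromArc ]′

  -- As `S` is finite and `to` injective, mapping `S` into itself is the same as permuting it: the
  -- setwise stabilizer of `S` is trivial.
  Rigid : List V → Set
  Rigid S = ∀ (σ : Automorphism (suc N) (suc K)) → let open Automorphism σ in
    (∀ {v} → v ∈ S → to v ∈ S) → ∀ v → to v ≡ v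

  -- Automorphisms: orientation, levels and first bits

  module Automorphisms (4≤N : 4 ≤ N) (1≤K : 1 ≤ K) where

    next-≢ : ∀ (i : Fin (suc N)) → next i ≢ i
    next-≢ i eq with ↑-free i (s≤s (≤-trans (s≤s z≤n) 4≤N)) eq
    ... | ()

    next²-≢ : ∀ (i : Fin (suc N)) → next (next i) ≢ i
    next²-≢ i eq with ↑-free i (s≤s (≤-trans (s≤s (s≤s z≤n)) 4≤N)) eq
    ... | ()

    -- This is what n ≥ 5 provides: with four levels, a 4-cycle could run once round all of them.
    next⁴-≢ : ∀ (i : Fin (suc N)) → next (next (next (next i))) ≢ i
    next⁴-≢ i eq with ↑-free i (s≤s 4≤N) eq
    ... | ()

    ⟶-asym : ∀ {u v} → u ⟶ v → ¬ v ⟶ u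
    ⟶-asym (arc l _) (arc l′ _) = next²-≢ _ (sym (trans l′ (cong next l)))

    -- Every 4-cycle is one of the K₂,₂ joining two pairs of twins on consecutive levels.
    middle-unique : ∀ {u u′ v w} → w ⟶ u → u ⟶ v → u′ ~ v → u′ ~ w → u′ ≡ u
    -- Since k ≥ 2, both `u` and `u′` have the second bit of `w` as first bit, and their other bits
    -- are given by `v`. The remaining cases clash on levels alone.
    middle-unique (arc _ s) a (inj₁ b) (inj₂ (arc _ s′)) =
      same-targets b a (trans (sym (s′ 0 1≤K)) (s 0 1≤K))
    middle-unique (arc l _) (arc l′ _) (inj₁ (arc m _)) (inj₁ (arc m′ _)) =
      contradiction (trans (cong next (sym (trans l (cong next m′)))) (trans (sym l′) m)) (next²-≢ _)
    middle-unique (arc l _) (arc l′ _) (inj₂ (arc m _)) (inj₂ (arc m′ _)) =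
      contradiction (trans (cong next (sym (trans l′ (cong next l)))) (trans (sym m) m′)) (next²-≢ _)
    middle-unique (arc l _) (arc l′ _) (inj₂ (arc m _)) (inj₁ (arc m′ _)) =
      contradiction (sym (trans m′ (cong next (trans m (cong next (trans l′ (cong next l))))))) (next⁴-≢ _)

    module _ (σ : Automorphism (suc N) (suc K)) where
      open Automorphism σ

      to-~ : ∀ {u v} → u ~ v → to u ~ to v
      to-~ a = Adj⇒~ (adj→ _ _ (~⇒Adj a))

      from-~ : ∀ {t v} → t ~ to v → from t ~ v
      from-~ {t} {v} a =
        Adj⇒~ (adj← _ _ (~⇒Adj (subst (_~ to v) (sym (to-from t)) a)))

      to-injective : ∀ {u v} → to u ≡ to v → u ≡ v
      to-injective {u} {v} eq = trans (sym (from-to u)) (trans (cong from eq) (from-to v))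

      to-middle-unique : ∀ {u v w t} → w ⟶ u → u ⟶ v → t ~ to v → t ~ to w → t ≡ to u
      to-middle-unique {t = t} a b c d =
        trans (sym (to-from t)) (cong to (middle-unique a b (from-~ c) (from-~ d)))

      -- If both image arcs left `to u`, or both entered it, then the corresponding twin of `to u`
      -- would be a second common neighbour of `to v` and `to w`, against `to-middle-unique`.
      arcs-consistent : ∀ {u v w} → w ⟶ u → u ⟶ v →
        (to w ⟶ to u × to u ⟶ to v) ⊎ (to u ⟶ to w × to v ⟶ to u)
      arcs-consistent {u} {v} {w} a b with to-~ (inj₁ a) | to-~ (inj₁ b)
      ... | inj₁ c | inj₁ d = inj₁ (c , d)
      ... | inj₂ c | inj₂ d = inj₂ (c , d)
      ... | inj₂ c | inj₁ d = contradiction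
        (to-middle-unique a b (inj₁ (flip-head-⟶ d)) (inj₁ (flip-head-⟶ c)))
        (flipBit-≢ (s≤s z≤n) (to u))
      ... | inj₁ c | inj₂ d = contradiction
        (to-middle-unique a b (inj₂ (flip-last-⟶ d)) (inj₂ (flip-last-⟶ c)))
        (flipBit-≢ ≤-refl (to u))

      Preserving Reversing : Set
      Preserving = ∀ {u v} → u ⟶ v → to u ⟶ to v
      Reversing  = ∀ {u v} → u ⟶ v → to v ⟶ to u

      private
        PreservesFrom ReversesFrom : V → Set
        PreservesFrom u = ∀ {v} → u ⟶ v → to u ⟶ to v
        ReversesFrom  u = ∀ {v} → u ⟶ v → to v ⟶ to u

        preserves-step : ∀ {u v} → u ⟶ v → PreservesFrom u → PreservesFrom v
        preserves-step a pres b with arcs-consistent a b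
        ... | inj₁ (_ , c) = c
        ... | inj₂ (c , _) = contradiction c (⟶-asym (pres a))

        reverses-step : ∀ {u v} → u ⟶ v → ReversesFrom u → ReversesFrom v
        reverses-step a rev b with arcs-consistent a b
        ... | inj₂ (_ , c) = c
        ... | inj₁ (c , _) = contradiction c (⟶-asym (rev a))

        spread : ∀ {P : V → Set} → (∀ {u v} → u ⟶ v → P u → P v) →
                 ∀ {d u v} → Path d u v → P u → P v
        spread step []      p = p
        spread step (q ▷ a) p = step a (spread step q p)

        everywhere : ∀ {P : V → Set} → (∀ {u v} → u ⟶ v → P u → P v) → ∀ {u} v → P u → P v
        everywhere step v = spread step (proj₂ (strongly-connected _ v))

        -- One arc into `v` is compared with every arc out of `v`, so all of these take its
        -- orientation.
        orientation-at : ∀ {u v} → u ⟶ v → PreservesFrom v ⊎ ReversesFrom v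
        orientation-at {u} {v} a with to-~ (inj₁ a)
        ... | inj₁ b = inj₁ λ c →
          [ proj₂ , (λ (d , _) → contradiction d (⟶-asym b)) ]′ (arcs-consistent a c)
        ... | inj₂ b = inj₂ λ c →
          [ (λ (d , _) → contradiction d (⟶-asym b)) , proj₂ ]′ (arcs-consistent a c)

      -- The orientation found at one vertex passes along arcs, and directed paths from that vertex
      -- reach all others.
      preserving-or-reversing : Preserving ⊎ Reversing
      preserving-or-reversing with orientation-at (proj₂ (successor (zero , replicate (suc K) false)))
      ... | inj₁ p = inj₁ λ {u} a → everywhere (λ b (q : PreservesFrom _) → preserves-step b q) u p a
      ... | inj₂ r = inj₂ λ {u} a → everywhere (λ b (q : ReversesFrom _) → reverses-step b q) u r a

      preserving-path : Preserving → ∀ {d u v} → Path d u v → Path d (to u) (to v)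
      preserving-path pres []      = []
      preserving-path pres (p ▷ a) = preserving-path pres p ▷ pres a

      reversing-path : Reversing → ∀ {d u v} → Path d u v → Path d (to v) (to u)
      reversing-path rev []      = []
      reversing-path rev (p ▷ a) = rev a ◁ reversing-path rev p

      -- Two vertices on one level have paths of length k to a common vertex `w`. The image paths
      -- have equal lengths and share an end (or, after reversal, a start), which forces their other
      -- ends onto one level.
      to-same-level : ∀ {u v} → level u ≡ level v → level (to u) ≡ level (to v)
      to-same-level {u} {v} eq = [ preserved , reversed ]′ preserving-or-reversing
        where
        y : Vec Bool (suc K)
        y = replicate _ false

        w : V
        w = level u ↑ suc K , y

        up : Path (suc K) u w
        up = connect-far (suc K) u y ≤-refl

        vp : Path (suc K) v w
        vp = subst (λ l → Path (suc K) v (l ↑ suc K , y)) (sym eq) (connect-far (suc K) v y ≤-refl)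

        preserved : Preserving → level (to u) ≡ level (to v)
        preserved pres = ↑-injective (suc K)
          (trans (sym (path-level (preserving-path pres up))) (path-level (preserving-path pres vp)))

        reversed : Reversing → level (to u) ≡ level (to v)
        reversed rev = trans (path-level (reversing-path rev up))
          (sym (path-level (reversing-path rev vp)))

      module _ (pres : Preserving) where

        levels-fixed : ∀ {u} → level (to u) ≡ level u → ∀ v → level (to v) ≡ level v
        levels-fixed {u} fixed v with strongly-connected u v
        ... | d , p = begin
            level (to v)      ≡⟨ path-level (preserving-path pres p) ⟩
            level (to u) ↑ d  ≡⟨ cong (_↑ d) fixed ⟩
            level u ↑ d       ≡⟨ path-level p ⟨
            level v           ∎
          where open ≡-Reasoning

        -- Vertices on a common level with a common first bit have a common
        -- ancestor K levels below, whose last bit is that first bit.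
        to-head-cong : ∀ {u v} → level u ≡ level v → bit 0 u ≡ bit 0 v → bit 0 (to u) ≡ bit 0 (to v)
        to-head-cong {u} {v} lev head = trans (sym (image u refl refl)) (image v (sym lev) (sym head))
          where
          w : V
          w = proj₁ (↑-surjective K (level u)) , replicate _ (bit 0 u)

          ancestor : ∀ x → level x ≡ level u → bit 0 x ≡ bit 0 u → Path K w x
          ancestor x l h = subst (λ i → Path K w (i , proj₂ x))
            (trans (proj₂ (↑-surjective K (level u))) (sym l))
            (connect K w (proj₂ x) λ where
              zero    _          → trans (nth-replicate K (bit 0 u) ≤-refl) (sym h)
              (suc j) (s≤s j+K<K) → contradiction (m≤n+m K j) (<⇒≱ j+K<K))

          image : ∀ x → level x ≡ level u → bit 0 x ≡ bit 0 u → bit K (to w) ≡ bit 0 (to x)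
          image x l h = path-head (preserving-path pres (ancestor x l h)) ≤-refl

        Anchored : Fin (suc N) → Set
        Anchored i = ∀ v → level v ≡ i → bit 0 (to v) ≡ bit 0 v

        -- By `to-head-cong` the automorphism induces a map on the two possible first bits of a
        -- level. It is injective: twins share an out-neighbour, so if their images agreed in the
        -- first bit they would coincide. Hence fixing one bit fixes the other.
        head-fixed⇒anchored : ∀ v → bit 0 (to v) ≡ bit 0 v → Anchored (level v)
        head-fixed⇒anchored v fixed w lev with bit 0 w ≟ᵇ bit 0 v
        ... | yes same = trans (to-head-cong {w} {v} lev same) (trans fixed (sym same))
        ... | no differ = begin
            bit 0 (to w)   ≡⟨ to-head-cong {w} {v′} lev (trans w₀ (sym v′₀)) ⟩
            bit 0 (to v′)  ≡⟨ ¬-not (λ eq → flipBit-≢ (s≤s z≤n) v (to-injective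
                                (same-targets (pres v′⟶s) (pres v⟶s) eq))) ⟩
            not (bit 0 (to v)) ≡⟨ cong not fixed ⟩
            not (bit 0 v)  ≡⟨ w₀ ⟨
            bit 0 w        ∎
          where
          open ≡-Reasoning
          v′ : V
          v′ = flipBit 0 v
          v⟶s = proj₂ (successor v)
          v′⟶s = flip-head-⟶ v⟶s
          v′₀ : bit 0 v′ ≡ not (bit 0 v)
          v′₀ = nth-toggle 0 (proj₂ v) (s≤s z≤n)
          w₀ : bit 0 w ≡ not (bit 0 v)
          w₀ = ¬-not differ

        -- After `d` arcs, bit `d` of `v` is a first bit, and the same holds along the image path. A
        -- fixed vertex therefore settles all k levels of its window.
        fixed⇒anchored : ∀ {v} → to v ≡ v → ∀ d → d < suc K → Anchored (level v ↑ d)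
        fixed⇒anchored {v} fixed d d<k with advance d v
        ... | w , p = subst Anchored (path-level p) (head-fixed⇒anchored w (begin
            bit 0 (to w)  ≡⟨ path-head (preserving-path pres p) d<k ⟨
            bit d (to v)  ≡⟨ cong (bit d) fixed ⟩
            bit d v       ≡⟨ path-head p d<k ⟩
            bit 0 w       ∎))
          where open ≡-Reasoning

        anchored⇒identity : (∀ v → level (to v) ≡ level v) → (∀ i → Anchored i) → ∀ v → to v ≡ v
        anchored⇒identity lev anch v = vertex-ext (lev v) bits
          where
          bits : ∀ d → d < suc K → bit d (to v) ≡ bit d v
          bits d d<k with advance d v
          ... | w , p = trans (path-head (preserving-path pres p) d<k)
            (trans (anch _ w refl) (sym (path-head p d<k)))

    -- Two rigid sets of ⌈n/k⌉ + 1 vertices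

    module Cover (p r : ℕ) (N≡ : N ≡ suc p * suc K + r) (r≤K : r ≤ K) where

      -- Dividing n - 1 instead of n gives q = ⌈n/k⌉ - 1 in all cases, and k divides n exactly when
      -- `r ≡ K`.
      q : ℕ
      q = suc p

      site : ℕ → Fin (suc N)
      site j = zero ↑ (suc j * suc K)

      toℕ-site : ∀ {j} → j < q → toℕ (site j) ≡ suc j * suc K
      toℕ-site {j} j<q = toℕ-↑ (s≤s (begin
          suc j * suc K  ≤⟨ *-monoˡ-≤ (suc K) j<q ⟩
          q * suc K      ≤⟨ m≤m+n _ r ⟩
          q * suc K + r  ≡⟨ N≡ ⟨
          N              ∎))
        where open ≤-Reasoning

      site≢0 : ∀ {j} → j < q → site j ≢ zero
      site≢0 j<q eq = 1+n≢0 (trans (sym (toℕ-site j<q)) (cong toℕ eq))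

      -- Since qk + r + 1 = n, this is the distance from the last site round to level 0. It lies
      -- inside the window of that site if `r < K`, and just past its end if `r ≡ K`.
      site-last : site p ↑ suc r ≡ zero
      site-last = begin
          site p ↑ suc r                 ≡⟨ ↑-+ zero (suc r) (q * suc K) ⟨
          zero ↑ (suc r + q * suc K)     ≡⟨ cong (zero ↑_) (+-comm (suc r) (q * suc K)) ⟩
          zero ↑ (q * suc K + suc r)     ≡⟨ cong (zero ↑_) (+-suc (q * suc K) r) ⟩
          zero ↑ suc (q * suc K + r)     ≡⟨ cong (λ m → zero ↑ suc m) N≡ ⟨
          zero ↑ suc N                   ≡⟨ ↑-wrap ⟩
          zero                           ∎
        where open ≡-Reasoning

      -- Divide `toℕ i` by k: quotient 0 puts `i` in the window at level 0, quotient `suc j` in that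
      -- of `site j`, and the remainder is the offset.
      covered : ∀ i → (∃ λ d → d < suc K × zero ↑ d ≡ i) ⊎
                      (∃₂ λ j d → j < q × d < suc K × site j ↑ d ≡ i)
      covered i with toℕ i / suc K | m≡m%n+[m/n]*n (toℕ i) (suc K)
      ... | zero  | t≡ = inj₁ (toℕ i % suc K , m%n<n (toℕ i) (suc K) ,
        trans (cong (zero ↑_) (sym (trans t≡ (+-identityʳ _)))) (zero↑toℕ i))
      ... | suc j | t≡ = inj₂ (j , toℕ i % suc K , s≤s⁻¹ (*-cancelʳ-< (suc K) (suc j) (suc q) bound) ,
        m%n<n (toℕ i) (suc K) ,
        trans (sym (↑-+ zero (toℕ i % suc K) (suc j * suc K)))
          (trans (cong (zero ↑_) (sym t≡)) (zero↑toℕ i)))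
        where
        open ≤-Reasoning
        bound : suc j * suc K < suc q * suc K
        bound = begin-strict
          suc j * suc K                    ≤⟨ m≤n+m _ (toℕ i % suc K) ⟩
          toℕ i % suc K + suc j * suc K    ≡⟨ t≡ ⟨
          toℕ i                            ≤⟨ s≤s⁻¹ (toℕ<n i) ⟩
          N                                ≡⟨ N≡ ⟩
          q * suc K + r                    ≤⟨ +-monoʳ-≤ (q * suc K) r≤K ⟩
          q * suc K + K                    <⟨ +-monoʳ-< (q * suc K) (n<1+n K) ⟩
          q * suc K + suc K                ≡⟨ +-comm (q * suc K) (suc K) ⟩
          suc q * suc K                    ∎

      module _ (σ : Automorphism (suc N) (suc K)) (pres : Preserving σ) where
        open Automorphism σ

        cover-fixed⇒identity : ∀ {u x} → level u ≡ zero → to u ≡ u →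
          (∀ {j} → j < q → to (site j , x) ≡ (site j , x)) → ∀ v → to v ≡ v
        cover-fixed⇒identity {u} lev fixed fixed-sites =
          anchored⇒identity σ pres (levels-fixed σ pres {u} (cong level fixed)) λ i → anchored i (covered i)
          where
          anchored : ∀ i → (∃ λ d → d < suc K × zero ↑ d ≡ i) ⊎
                     (∃₂ λ j d → j < q × d < suc K × site j ↑ d ≡ i) → Anchored σ pres i
          anchored i (inj₁ (d , d<k , refl)) =
            subst (λ l → Anchored σ pres (l ↑ d)) lev (fixed⇒anchored σ pres fixed d d<k)
          anchored i (inj₂ (j , d , j<q , d<k , refl)) = fixed⇒anchored σ pres (fixed-sites j<q) d d<k

      zeros ones : Vec Bool (suc K)
      zeros = replicate _ false
      ones  = replicate _ true

      twins : List V
      twins = (zero , zeros) ∷ (zero , toggle 0 zeros) ∷ applyUpTo (λ j → site j , zeros) q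

      -- The sites carry `ones` so that they are not adjacent to the two vertices with `zeros`: for
      -- k ≥ 2 the ends of an arc share a bit.
      edge : List V
      edge = (zero , zeros) ∷ (next zero , zeros) ∷ applyUpTo (λ j → site j , ones) q

      -- Level 0 alone holds two members, so the twins stay there as a pair. Once reversal is
      -- excluded, every site is fixed, being the only member on its level, and it remains to see
      -- that the twins are not swapped.
      twins-rigid : r < K → Rigid twins
      twins-rigid r<K σ stable = by-orientation (preserving-or-reversing σ)
        where
        open Automorphism σ
        u u′ : V
        u  = zero , zeros
        u′ = zero , toggle 0 zeros

        data View : V → Set where
          first  : View u
          second : View u′
          other  : ∀ {j} → j < q → View (site j , zeros)

        view : ∀ {v} → v ∈ twins → View v
        view (here refl) = first
        view (there (here refl)) = second
        view (there (there m)) with ∈-applyUpTo⁻ (λ j → site j , zeros) m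
        ... | j , j<q , refl = other j<q

        u∈ : u ∈ twins
        u∈ = here refl
        u′∈ : u′ ∈ twins
        u′∈ = there (here refl)
        site∈ : ∀ {j} → j < q → (site j , zeros) ∈ twins
        site∈ j<q = there (there (∈-applyUpTo⁺ (λ j → site j , zeros) j<q))

        other-unique : ∀ {j v} → j < q → View v → level v ≡ site j → v ≡ (site j , zeros)
        other-unique j<q first  eq = contradiction (sym eq) (site≢0 j<q)
        other-unique j<q second eq = contradiction (sym eq) (site≢0 j<q)
        other-unique j<q (other i<q) eq = cong (_, zeros) eq

        u≢u′ : u ≢ u′
        u≢u′ ()

        level-to-u : level (to u) ≡ zero
        level-to-u = go refl refl (view (stable u∈)) (view (stable u′∈))
          where
          go : ∀ {v v′} → to u ≡ v → to u′ ≡ v′ → View v → View v′ → level v ≡ zero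
          go _ _ first  _ = refl
          go _ _ second _ = refl
          -- If `u` went to a site, `u′` would go to the same level, whose only member is that site.
          go e e′ (other j<q) w = contradiction
            (to-injective σ (trans e (trans (sym (other-unique j<q w
              (trans (cong level (sym e′)) (trans (to-same-level σ {u′} {u} refl) (cong level e))))) (sym e′))))
            u≢u′

        heads-differ : ∀ {v v′} → View v → View v′ → level v ≡ zero → level v′ ≡ zero →
          bit 0 v ≡ bit 0 v′ → v ≡ v′
        heads-differ first  first  _ _ _ = refl
        heads-differ first  second _ _ ()
        heads-differ second first  _ _ ()
        heads-differ second second _ _ _ = refl
        heads-differ (other j<q) _ l _ _ = contradiction l (site≢0 j<q)
        heads-differ _ (other j<q) _ l _ = contradiction l (site≢0 j<q)

        level-to-u′ : level (to u′) ≡ zero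
        level-to-u′ = trans (to-same-level σ {u′} {u} refl) level-to-u

        -- The twins have a common out-neighbour; a reversal would make their images,
        -- which are the twins again, agree in the first bit.
        not-reversing : ¬ Reversing σ
        not-reversing rev = u≢u′ (to-injective σ (heads-differ (view (stable u∈)) (view (stable u′∈))
          level-to-u level-to-u′ (trans (sym (bit-shift (rev u⟶s) 0 1≤K)) (bit-shift (rev (flip-head-⟶ u⟶s)) 0 1≤K))))
          where
          u⟶s = proj₂ (successor u)

        preserving : Preserving σ → ∀ v → to v ≡ v
        preserving pres = cover-fixed⇒identity σ pres refl fixed-u fixed-site
          where
          fixed-site : ∀ {j} → j < q → to (site j , zeros) ≡ (site j , zeros)
          fixed-site j<q = other-unique j<q (view (stable (site∈ j<q)))
            (levels-fixed σ pres {u} level-to-u _)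

          -- The window of the last site reaches round to level 0, since `r < K`; this rules out the
          -- swap of the twins.
          anchored-0 : Anchored σ pres zero
          anchored-0 = subst (Anchored σ pres) site-last
            (fixed⇒anchored σ pres (fixed-site {p} ≤-refl) (suc r) (s≤s r<K))

          fixed-u : to u ≡ u
          fixed-u = heads-differ (view (stable u∈)) first level-to-u refl (anchored-0 u refl)

        by-orientation : Preserving σ ⊎ Reversing σ → ∀ v → to v ≡ v
        by-orientation (inj₁ pres) = preserving pres
        by-orientation (inj₂ rev)  = ⊥-elim (not-reversing rev)

      -- Now the windows at level 0 and at the sites tile the cycle, and no site controls level 0.
      -- The arc from `u` to `u′` is instead recognised as the only arc inside the class, so it is
      -- either kept, which fixes `u`, or turned round.
      edge-rigid : r ≡ K → Rigid edge
      edge-rigid refl σ stable = by-orientation (preserving-or-reversing σ)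
        where
        open Automorphism σ
        u u′ : V
        u  = zero , zeros
        u′ = next zero , zeros

        u⟶u′ : u ⟶ u′
        u⟶u′ = arc refl λ j j<K → trans (nth-replicate (suc j) false (s≤s j<K))
          (sym (nth-replicate j false (m≤n⇒m≤1+n j<K)))

        data View : V → Set where
          first  : View u
          second : View u′
          other  : ∀ {j} → j < q → View (site j , ones)

        view : ∀ {v} → v ∈ edge → View v
        view (here refl) = first
        view (there (here refl)) = second
        view (there (there m)) with ∈-applyUpTo⁻ (λ j → site j , ones) m
        ... | j , j<q , refl = other j<q

        u∈ : u ∈ edge
        u∈ = here refl
        u′∈ : u′ ∈ edge
        u′∈ = there (here refl)
        site∈ : ∀ {j} → j < q → (site j , ones) ∈ edge
        site∈ j<q = there (there (∈-applyUpTo⁺ (λ j → site j , ones) j<q))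

        zeros↛ones : ∀ {i j} → ¬ (i , zeros) ⟶ (j , ones)
        zeros↛ones {i} {j} a with () ← trans (sym (nth-replicate 1 false (s≤s 1≤K))) (bit-shift a 0 1≤K)

        ones↛zeros : ∀ {i j} → ¬ (i , ones) ⟶ (j , zeros)
        ones↛zeros {i} {j} a with () ← trans (sym (nth-replicate 1 true (s≤s 1≤K))) (bit-shift a 0 1≤K)

        next-0≢site : ∀ {j} → j < q → next zero ≢ site j
        next-0≢site {j} j<q eq = <⇒≢ 1≤K (sym (suc-injective (m*n≡1⇒n≡1 (suc j) (suc K) (begin
            suc j * suc K     ≡⟨ toℕ-site j<q ⟨
            toℕ (site j)      ≡⟨ cong toℕ eq ⟨
            toℕ (zero ↑ 1)    ≡⟨ toℕ-↑ (s≤s (≤-trans (s≤s z≤n) 4≤N)) ⟩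
            1                 ∎))))
          where open ≡-Reasoning

        -- Sites are k ≥ 2 levels apart, and the level after the last site does not wrap round to 0,
        -- because `r ≡ K` is positive.
        site↛site : ∀ {i j} → i < q → j < q → site j ≢ next (site i)
        site↛site {i} {j} i<q j<q eq = <⇒≱ 1≤K (s≤s⁻¹ (+-cancelʳ-≤ (suc i * suc K) (suc K) 1 (begin
            suc (suc i) * suc K    ≤⟨ *-monoˡ-≤ (suc K) (*-cancelʳ-< (suc K) (suc i) (suc j) below) ⟩
            suc j * suc K          ≡⟨ step ⟩
            suc (suc i * suc K)    ∎)))
          where
          open ≤-Reasoning
          inside : suc (suc i * suc K) < suc N
          inside = s≤s (begin-strict
            suc i * suc K          ≤⟨ *-monoˡ-≤ (suc K) i<q ⟩
            q * suc K              <⟨ m<m+n (q * suc K) 1≤K ⟩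
            q * suc K + K          ≡⟨ N≡ ⟨
            N                      ∎)
          step : suc j * suc K ≡ suc (suc i * suc K)
          step = trans (sym (toℕ-site j<q)) (trans (cong toℕ eq) (toℕ-↑ inside))
          below : suc i * suc K < suc j * suc K
          below = ≤-reflexive (sym step)

        arc-unique : ∀ {v v′} → View v → View v′ → v ⟶ v′ → v ≡ u × v′ ≡ u′
        arc-unique first       first       a = contradiction (sym (level-next a)) (next-≢ zero)
        arc-unique first       second      a = refl , refl
        arc-unique second      first       a = contradiction (sym (level-next a)) (next²-≢ zero)
        arc-unique second      second      a = contradiction (sym (level-next a)) (next-≢ (next zero))
        arc-unique first       (other _)   a = contradiction a zeros↛ones
        arc-unique second      (other _)   a = contradiction a zeros↛ones
        arc-unique (other _)   first       a = contradiction a ones↛zeros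
        arc-unique (other _)   second      a = contradiction a ones↛zeros
        arc-unique (other i<q) (other j<q) a = contradiction (level-next a) (site↛site i<q j<q)

        -- A reversal swaps `u` and `u′`. As `site 0` lies k levels above `u`, its image must lie k
        -- levels below `u′`, which is on level 1. But `u` and `u′` are already taken as images, and
        -- k levels above a site comes the next site or, from the last one, level 0.
        not-reversing : ¬ Reversing σ
        not-reversing rev with arc-unique (view (stable u′∈)) (view (stable u∈)) (rev u⟶u′)
        ... | to-u′ , to-u = go refl (view (stable (site∈ {0} (s≤s z≤n))))
          where
          v : V
          v = site 0 , ones

          level-to-v : next zero ≡ level (to v) ↑ suc K
          level-to-v = trans (cong level (sym to-u)) (path-level (reversing-path σ rev
            (subst (λ l → Path (suc K) u (zero ↑ l , ones)) (sym (*-identityˡ (suc K)))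
              (connect-far (suc K) u ones ≤-refl))))

          go : ∀ {w} → to v ≡ w → View w → ⊥
          go e first with () ← to-injective σ (trans e (sym to-u′))
          go e second with () ← to-injective σ (trans e (sym to-u))
          go e (other {j} j<q) with m≤n⇒m<n∨m≡n j<q
          ... | inj₁ lt = next-0≢site lt (trans level-to-v (trans (cong (λ w → level w ↑ suc K) e)
            (sym (↑-+ zero (suc K) (suc j * suc K)))))
          ... | inj₂ refl = next-≢ zero (trans level-to-v (trans (cong (λ w → level w ↑ suc K) e) site-last))

        preserving : Preserving σ → ∀ v → to v ≡ v
        preserving pres with arc-unique (view (stable u∈)) (view (stable u′∈)) (pres u⟶u′)
        ... | to-u , _ = cover-fixed⇒identity σ pres refl to-u λ j<q →
          other-unique j<q (view (stable (site∈ j<q))) (levels-fixed σ pres {u} (cong level to-u) _)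
          where
          other-unique : ∀ {j v} → j < q → View v → level v ≡ site j → v ≡ (site j , ones)
          other-unique j<q first  eq = contradiction (sym eq) (site≢0 j<q)
          other-unique {j} j<q second eq = contradiction eq (next-0≢site j<q)
          other-unique j<q (other i<q) eq = cong (_, ones) eq

        by-orientation : Preserving σ ⊎ Reversing σ → ∀ v → to v ≡ v
        by-orientation (inj₁ pres) = preserving pres
        by-orientation (inj₂ rev)  = ⊥-elim (not-reversing rev)

-- Counting and exhaustive search in finite types

lookup-injective : ∀ {A : Set} {xs : List A} → Unique xs → ∀ i j → lookup xs i ≡ lookup xs j → i ≡ j
lookup-injective (_ ∷ _) zero    zero    _  = refl
lookup-injective (a ∷ _) zero    (suc j) eq = contradiction eq (All.lookup a (∈-lookup j))
lookup-injective (a ∷ _) (suc i) zero    eq = contradiction (sym eq) (All.lookup a (∈-lookup i))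
lookup-injective (_ ∷ u) (suc i) (suc j) eq = cong suc (lookup-injective u i j eq)

-- Pigeonhole: sending a place in `xs` to the place of its entry in `ys` is injective. It bounds
-- class sizes from above and also counts covered levels.
unique-⊆⇒length-≤ : ∀ {A : Set} {xs ys : List A} → Unique xs → (∀ {x} → x ∈ xs → x ∈ ys) →
                    length xs ≤ length ys
unique-⊆⇒length-≤ {A} {xs} u sub = injective⇒≤ {f = λ i → Any.index (sub (∈-lookup i))} λ {i} {j} eq →
  lookup-injective u i j (index-injective (setoid A) (sub (∈-lookup i)) (sub (∈-lookup j)) eq)

Searchable : Set → Set₁
Searchable A = ∀ {P : A → Set} → Decidable P → Dec (∃ P)

search-Vec : ∀ {A} → Searchable A → ∀ n → Searchable (Vec A n)
search-Vec search zero    P? = map′ ([] ,_) (λ { ([] , p) → p }) (P? [])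
search-Vec search (suc n) P? =
  map′ (λ (x , xs , p) → x ∷ xs , p) (λ { (x ∷ xs , p) → x , xs , p })
    (search λ x → search-Vec search n λ xs → P? (x ∷ xs))

module _ {A : Set} {xs : List A} (complete : ∀ a → a ∈ xs) where

  search : Searchable A
  search P? = map′ (λ m → let (a , _ , p) = find m in a , p) (λ (a , p) → lose (complete a) p) (Any.any? P? xs)

  ∀? : ∀ {P : A → Set} → Decidable P → Dec (∀ a → P a)
  ∀? P? = map′ (λ all a → All.lookup all (complete a)) (λ p → All.tabulate λ {a} _ → p a) (All.all? P? xs)

  -- Without function extensionality, only predicates respecting pointwise equality can be searched.
  search-function : ∀ {B} → Searchable B → {P : (A → B) → Set} →
    (∀ {f g} → f ≗ g → P f → P g) → Decidable P → Dec (∃ P)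
  search-function {B} searchB resp P? =
    map′ (λ (t , p) → eval t , p) (λ (f , p) → table f , resp (λ a → sym (eval-table f a)) p)
      (search-Vec searchB (length xs) (P? ∘ eval))
    where
    eval : Vec B (length xs) → A → B
    eval t a = Vec.lookup t (Any.index (complete a))
    table : (A → B) → Vec B (length xs)
    table f = Vec.tabulate (f ∘ lookup xs)
    eval-table : ∀ f a → eval (table f) a ≡ f a
    eval-table f a = trans (lookup∘tabulate (f ∘ lookup xs) (Any.index (complete a)))
      (cong f (sym (lookup-index (complete a))))

∈-allVecs : ∀ {k} (x : Vec Bool k) → x ∈ allVecs k
∈-allVecs []                        = here refl
∈-allVecs {suc k} (true ∷ x)  = ∈-++⁺ˡ (∈-map⁺ (true ∷_) (∈-allVecs x))
∈-allVecs {suc k} (false ∷ x) = ∈-++⁺ʳ (map (true ∷_) (allVecs k)) (∈-map⁺ (false ∷_) (∈-allVecs x))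

allVecs-unique : ∀ k → Unique (allVecs k)
allVecs-unique zero    = All.[] ∷ []
allVecs-unique (suc k) = ++⁺ (map⁺ ∷-injectiveʳ (allVecs-unique k)) (map⁺ ∷-injectiveʳ (allVecs-unique k))
  λ (m , m′) → disjoint (∈-map⁻ (true ∷_) m) (∈-map⁻ (false ∷_) m′)
  where
  disjoint : ∀ {v : Vec Bool (suc k)} → (∃ λ x → x ∈ allVecs k × v ≡ true ∷ x) →
             (∃ λ x → x ∈ allVecs k × v ≡ false ∷ x) → ⊥
  disjoint (_ , _ , refl) (_ , _ , ())

module _ {n k : ℕ} where

  ∈-allVertices : ∀ (v : Vertex n k) → v ∈ allVertices n k
  ∈-allVertices (i , x) = ∈-cartesianProduct⁺ (∈-allFin i) (∈-allVecs x)

  allVertices-unique : Unique (allVertices n k)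
  allVertices-unique = cartesianProduct⁺ (allFin⁺ n) (allVecs-unique k)

  infix 4 _≟ⱽ_
  _≟ⱽ_ : (u v : Vertex n k) → Dec (u ≡ v)
  _≟ⱽ_ = ×-≡-dec _≟ᶠ_ (Vec-≡-dec _≟ᵇ_)

  open import Data.List.Membership.DecPropositional _≟ⱽ_ using (_∈?_)

  colorOf : List (Vertex n k) → Vertex n k → Fin 2
  colorOf S v = if does (v ∈? S) then suc zero else zero

  colorOf-∈ : ∀ S {v} → v ∈ S → colorOf S v ≡ suc zero
  colorOf-∈ S {v} v∈S = cong (λ b → if b then suc zero else zero) (dec-true (v ∈? S) v∈S)

  ∈-colorOf : ∀ S {v} → colorOf S v ≡ suc zero → v ∈ S
  ∈-colorOf S {v} eq with v ∈? S
  ... | yes v∈S = v∈S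
  ∈-colorOf S {v} () | no _

  classSize-colorOf : ∀ S → classSize n k 2 (colorOf S) (suc zero) ≤ length S
  classSize-colorOf S = unique-⊆⇒length-≤ (filter⁺ (λ v → colorOf S v ≟ᶠ suc zero) allVertices-unique)
    λ m → ∈-colorOf S (proj₂ (∈-filter⁻ (λ v → colorOf S v ≟ᶠ suc zero) {xs = allVertices n k} m))

  classSize-cong : ∀ {d} {c c′ : Vertex n k → Fin d} → c ≗ c′ → ∀ i → classSize n k d c i ≡ classSize n k d c′ i
  classSize-cong {c = c} {c′} eq i = cong length (filter-≐ (λ v → c v ≟ᶠ i) (λ v → c′ v ≟ᶠ i)
    ((λ {v} p → trans (sym (eq v)) p) , (λ {v} p → trans (eq v) p)) (allVertices n k))

  Distinguishing-cong : ∀ {d} {c c′ : Vertex n k → Fin d} → c ≗ c′ → Distinguishing n k d c → Distinguishing n k d c′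
  Distinguishing-cong eq dist σ pres = dist σ λ v → trans (eq _) (trans (pres v) (sym (eq v)))

  -- The search is for a counterexample, namely a map and its inverse that respect adjacency and
  -- colours and move some vertex. Decidable equality of vertices turns its absence into the
  -- identity.
  Distinguishing? : (∀ u v → Dec (Adj n k u v)) → ∀ {d} (c : Vertex n k → Fin d) → Dec (Distinguishing n k d c)
  Distinguishing? Adj? {d} c = map′ none⇒distinguishing distinguishing⇒none
    (¬? (search-function ∈-allVertices (search ∈-allVertices)
      (λ f≗f′ (g , b) → g , Bad-resp f≗f′ (λ _ → refl) b)
      λ f → search-function ∈-allVertices (search ∈-allVertices) (Bad-resp (λ _ → refl)) (Bad? f)))
    where
    V = Vertex n k

    record Bad (f g : V → V) : Set where
      pattern
      constructor bad
      field
        fg     : ∀ v → f (g v) ≡ v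
        gf     : ∀ v → g (f v) ≡ v
        adj⁺   : ∀ u v → Adj n k u v → Adj n k (f u) (f v)
        adj⁻   : ∀ u v → Adj n k (f u) (f v) → Adj n k u v
        color  : ∀ v → c (f v) ≡ c v
        moves  : ∃ λ v → f v ≢ v

    Bad? : ∀ f g → Dec (Bad f g)
    Bad? f g = map′ (λ (a , b , p , q , r , s) → bad a b p q r s)
      (λ (bad a b p q r s) → a , b , p , q , r , s)
      (∀? ∈-allVertices (λ v → f (g v) ≟ⱽ v) ×-dec
       ∀? ∈-allVertices (λ v → g (f v) ≟ⱽ v) ×-dec
       ∀? ∈-allVertices (λ u → ∀? ∈-allVertices λ v → Adj? u v →-dec Adj? (f u) (f v)) ×-dec
       ∀? ∈-allVertices (λ u → ∀? ∈-allVertices λ v → Adj? (f u) (f v) →-dec Adj? u v) ×-dec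
       ∀? ∈-allVertices (λ v → c (f v) ≟ᶠ c v) ×-dec
       search ∈-allVertices (λ v → ¬? (f v ≟ⱽ v)))

    Bad-resp : ∀ {f f′ g g′} → f ≗ f′ → g ≗ g′ → Bad f g → Bad f′ g′
    Bad-resp {f} {f′} {g} {g′} f≗ g≗ (bad a b p q r (v₀ , s)) = bad
      (λ v → trans (sym (trans (cong f (g≗ v)) (f≗ (g′ v)))) (a v))
      (λ v → trans (sym (trans (cong g (f≗ v)) (g≗ (f′ v)))) (b v))
      (λ u v e → subst₂ (Adj n k) (f≗ u) (f≗ v) (p u v e))
      (λ u v e → q u v (subst₂ (Adj n k) (sym (f≗ u)) (sym (f≗ v)) e))
      (λ v → trans (cong c (sym (f≗ v))) (r v))
      (v₀ , s ∘ trans (f≗ v₀))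

    none⇒distinguishing : ¬ (∃ λ f → ∃ (Bad f)) → Distinguishing n k d c
    none⇒distinguishing none σ pres v = decidable-stable (to v ≟ⱽ v) λ moved →
      none (to , from , bad to-from from-to adj→ adj← pres (v , moved))
      where open Automorphism σ

    distinguishing⇒none : Distinguishing n k d c → ¬ (∃ λ f → ∃ (Bad f))
    distinguishing⇒none dist (f , g , bad a b p q r (v , moved)) = moved (dist
      (record { to = f ; from = g ; to-from = a ; from-to = b ; adj→ = p ; adj← = q }) r v)

length-cartesianProductWith : ∀ {A B C : Set} (f : A → B → C) xs ys →
                              length (cartesianProductWith f xs ys) ≡ length xs * length ys
length-cartesianProductWith f []       ys = refl
length-cartesianProductWith f (x ∷ xs) ys = trans (length-++ (map (f x) ys))
  (cong₂ _+_ (length-map (f x) ys) (length-cartesianProductWith f xs ys))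

two-colors : ∀ {a b i : Fin 2} → a ≢ i → b ≢ i → a ≡ b
two-colors {zero}     {zero}     _ _ = refl
two-colors {suc zero} {suc zero} _ _ = refl
two-colors {zero}     {suc zero} {zero}     a≢i _ = contradiction refl a≢i
two-colors {zero}     {suc zero} {suc zero} _ b≢i = contradiction refl b≢i
two-colors {suc zero} {zero}     {zero}     _ b≢i = contradiction refl b≢i
two-colors {suc zero} {zero}     {suc zero} a≢i _ = contradiction refl a≢i

-- Flips at a position and the lower bound

module Flips (N K : ℕ) where
  open PX N K

  flipIf : Bool → Bool → Bool
  flipIf d b = if d then not b else b

  flipIf-involutive : ∀ d b → flipIf d (flipIf d b) ≡ b
  flipIf-involutive true  b = not-involutive b
  flipIf-involutive false b = refl

  -- The argument `i` is the cycle position of the leading bit and advances with the string.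
  flipString : ∀ {m} → Fin (suc N) → Fin (suc N) → Vec Bool m → Vec Bool m
  flipString p i []      = []
  flipString p i (b ∷ x) = flipIf (does (i ≟ᶠ p)) b ∷ flipString p (next i) x

  nth-flipString : ∀ {m} p i (x : Vec Bool m) j → j < m →
    nth j (flipString p i x) ≡ flipIf (does (i ↑ j ≟ᶠ p)) (nth j x)
  nth-flipString p i (b ∷ x) zero    _         = refl
  nth-flipString p i (b ∷ x) (suc j) (s≤s j<m) = trans (nth-flipString p (next i) x j j<m)
    (cong (λ l → flipIf (does (l ≟ᶠ p)) (nth j x)) (next-↑ i j))

  flip : Fin (suc N) → V → V
  flip p (i , x) = i , flipString p i x

  flip-involutive : ∀ p v → flip p (flip p v) ≡ v
  flip-involutive p v@(i , x) = vertex-ext {flip p (flip p v)} {v} refl λ j j<k →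
    trans (nth-flipString p i (flipString p i x) j j<k)
      (trans (cong (flipIf (does (i ↑ j ≟ᶠ p))) (nth-flipString p i x j j<k))
        (flipIf-involutive (does (i ↑ j ≟ᶠ p)) (nth j x)))

  -- The bits that an arc identifies, `suc j` in the tail and `j` in the head, sit at one position
  -- of the cycle, so they are flipped together.
  flip-⟶ : ∀ p {u v} → u ⟶ v → flip p u ⟶ flip p v
  flip-⟶ p {i , x} {_ , y} (arc refl s) = arc refl λ j j<K → begin
      nth (suc j) (flipString p i x)                    ≡⟨ nth-flipString p i x (suc j) (s≤s j<K) ⟩
      flipIf (does (i ↑ suc j ≟ᶠ p)) (nth (suc j) x)     ≡⟨ cong₂ (λ l → flipIf (does (l ≟ᶠ p))) (sym (next-↑ i j)) (s j j<K) ⟩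
      flipIf (does (next i ↑ j ≟ᶠ p)) (nth j y)          ≡⟨ nth-flipString p (next i) y j (m≤n⇒m≤1+n j<K) ⟨
      nth j (flipString p (next i) y)                   ∎
    where open ≡-Reasoning

  flip-Adj : ∀ p {u v} → Adj (suc N) (suc K) u v → Adj (suc N) (suc K) (flip p u) (flip p v)
  flip-Adj p {u} {v} a with Adj⇒~ {u} {v} a
  ... | inj₁ b = inj₁ (toArc (flip-⟶ p b))
  ... | inj₂ b = inj₂ (toArc (flip-⟶ p b))

  flipAutomorphism : Fin (suc N) → Automorphism (suc N) (suc K)
  flipAutomorphism p = record
    { to      = flip p
    ; from    = flip p
    ; to-from = flip-involutive p
    ; from-to = flip-involutive p
    ; adj→    = λ u v → flip-Adj p {u} {v}
    ; adj←    = λ u v a → subst₂ (Adj (suc N) (suc K)) (flip-involutive p u) (flip-involutive p v)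
                  (flip-Adj p {flip p u} {flip p v} a)
    }

  flip-uncovered : ∀ p v → (∀ j → j < suc K → level v ↑ j ≢ p) → flip p v ≡ v
  flip-uncovered p v@(i , x) away = vertex-ext {flip p v} {v} refl λ j j<k →
    trans (nth-flipString p i x j j<k)
      (cong (λ d → flipIf d (nth j x)) (dec-false (i ↑ j ≟ᶠ p) (away j j<k)))

  flip-≢ : ∀ p (x : Vec Bool (suc K)) → flip p (p , x) ≢ (p , x)
  flip-≢ p (b ∷ x) eq = not-¬ refl (sym (trans (cong (λ d → flipIf d b) (sym (dec-true (p ≟ᶠ p) refl))) (cong (bit 0) eq)))

  -- Each vertex covers k positions, so fewer than n are listed in `positions`, and some level is
  -- missing.
  uncovered : ∀ (S : List V) → length S * suc K < suc N →
    ∃ λ p → ∀ {v} → v ∈ S → ∀ j → j < suc K → level v ↑ j ≢ p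
  uncovered S small = missing (any? λ p → ¬? (p ∈? positions))
    where
    open import Data.List.Membership.DecPropositional (_≟ᶠ_ {suc N}) using (_∈?_)

    positions : List (Fin (suc N))
    positions = cartesianProductWith (λ v j → level v ↑ j) S (upTo (suc K))

    size : length positions ≡ length S * suc K
    size = trans (length-cartesianProductWith _ S (upTo (suc K)))
      (cong (length S *_) (length-applyUpTo (λ j → j) (suc K)))

    missing : Dec (∃ λ p → ¬ p ∈ positions) →
              ∃ λ p → ∀ {v} → v ∈ S → ∀ j → j < suc K → level v ↑ j ≢ p
    missing (yes (p , p∉)) = p , λ v∈S j j<k eq → p∉ (subst (_∈ positions) eq
      (∈-cartesianProductWith⁺ (λ v j → level v ↑ j) v∈S (∈-upTo⁺ j<k)))
    missing (no none) = contradiction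
      (subst (_≤ length positions) (length-tabulate {n = suc N} (λ i → i))
        (unique-⊆⇒length-≤ (allFin⁺ (suc N)) λ {p} _ →
          decidable-stable (p ∈? positions) λ p∉ → none (p , p∉)))
      (<⇒≱ (subst (_< suc N) (sym size) small))

  -- Were the class smaller, the flip at an uncovered position would fix it pointwise and hence
  -- preserve the colouring without being the identity.
  class-covers : ∀ c → Distinguishing (suc N) (suc K) 2 c → ∀ i →
                 suc N ≤ classSize (suc N) (suc K) 2 c i * suc K
  class-covers c dist i = ≮⇒≥ λ small → impossible (uncovered members small)
    where
    members = filter (λ v → c v ≟ᶠ i) (allVertices (suc N) (suc K))

    impossible : ¬ (∃ λ p → ∀ {v} → v ∈ members → ∀ j → j < suc K → level v ↑ j ≢ p)
    impossible (p , away) = flip-≢ p (replicate _ false) (dist (flipAutomorphism p) preserved _)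
      where
      class-fixed : ∀ {v} → c v ≡ i → flip p v ≡ v
      class-fixed {v} eq = flip-uncovered p v (away (∈-filter⁺ (λ v → c v ≟ᶠ i) (∈-allVertices v) eq))

      preserved : ∀ v → c (flip p v) ≡ c v
      preserved v with c v ≟ᶠ i | c (flip p v) ≟ᶠ i
      ... | yes eq | _      = cong c (class-fixed eq)
      -- A vertex cannot enter the class from outside: its image would be fixed by the flip, which
      -- is its own inverse.
      ... | no  _  | yes eq = cong c (trans (sym (class-fixed eq)) (flip-involutive p v))
      ... | no  ≢i | no ≢i′ = two-colors ≢i′ ≢i

  _⟶?_ : ∀ u v → Dec (u ⟶ v)
  u ⟶? v = map′ (λ (l , s) → arc l (λ j → s {j})) (λ (arc l s) → l , λ {j} → s j)
    ((level v ≟ᶠ next (level u)) ×-dec allUpTo? (λ j → bit (suc j) u ≟ᵇ bit j v) K)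

  Adj? : ∀ u v → Dec (Adj (suc N) (suc K) u v)
  Adj? u v = map′ ~⇒Adj Adj⇒~ ((u ⟶? v) ⊎-dec (v ⟶? u))

  distinguishing-size? : ∀ m → Dec (Σ (V → Fin 2) λ c → Distinguishing (suc N) (suc K) 2 c ×
                           Σ (Fin 2) λ i → classSize (suc N) (suc K) 2 c i ≡ m)
  distinguishing-size? m = search-function ∈-allVertices any?
    (λ eq (dist , i , size) → Distinguishing-cong eq dist , i , trans (sym (classSize-cong eq i)) size)
    (λ c → Distinguishing? Adj? c ×-dec any? (λ i → classSize (suc N) (suc K) 2 c i ≟ m))

-- The upper bound and the theorem

rigid⇒distinguishing : ∀ {N K} (S : List (Vertex (suc N) (suc K))) → PX.Rigid N K S →
  Distinguishing (suc N) (suc K) 2 (colorOf S)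
rigid⇒distinguishing S rigid σ pres = rigid σ λ {v} v∈S → ∈-colorOf S (trans (pres v) (colorOf-∈ S v∈S))

ceilDiv-≤ : ∀ {n K s} → n ≤ s * suc K → ceilDiv n (suc K) ≤ s
ceilDiv-≤ {n} {K} {s} n≤ = s≤s⁻¹ (*-cancelʳ-< (suc K) (ceilDiv n (suc K)) (suc s) (begin-strict
    ceilDiv n (suc K) * suc K  ≤⟨ m/n*n≤m (n + K) (suc K) ⟩
    n + K                      ≤⟨ +-monoˡ-≤ K n≤ ⟩
    s * suc K + K              <⟨ +-monoʳ-< (s * suc K) (n<1+n K) ⟩
    s * suc K + suc K          ≡⟨ +-comm (s * suc K) (suc K) ⟩
    suc s * suc K              ∎))
  where open ≤-Reasoning

-- This links ⌈n/k⌉ to the division of n - 1 on which `Cover` is built.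
ceilDiv-suc : ∀ N K → ceilDiv (suc N) (suc K) ≡ suc (N / suc K)
ceilDiv-suc N K = begin
    (suc N + K) / suc K                    ≡⟨ cong (_/ suc K) (sym (+-suc N K)) ⟩
    (N + suc K) / suc K                    ≡⟨ m/n≡1+[m∸n]/n (m≤n+m (suc K) N) ⟩
    suc ((N + suc K ∸ suc K) / suc K)      ≡⟨ cong (λ m → suc (m / suc K)) (m+n∸n≡m N (suc K)) ⟩
    suc (N / suc K)                        ∎
  where open ≡-Reasoning

few-vertices : ∀ N K → 4 ≤ N → 1 ≤ K → suc K ≤ N → Σ (Vertex (suc N) (suc K) → Fin 2) λ c →
  Distinguishing (suc N) (suc K) 2 c × classSize (suc N) (suc K) 2 c (suc zero) ≤ ceilDiv (suc N) (suc K) + 1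
few-vertices N K 4≤N 1≤K k≤N
  with N / suc K | m≡m%n+[m/n]*n N (suc K) | ceilDiv-suc N K
-- Quotient 0 would mean n - 1 < k, against k < n; so there is at least one site.
... | zero  | N≡ | _ = contradiction (m%n<n N (suc K)) (≤⇒≯ (subst (suc K ≤_) (trans N≡ (+-identityʳ _)) k≤N))
... | suc p | N≡ | ceil≡ = choose (m≤n⇒m<n∨m≡n r≤K)
  where
  r = N % suc K
  r≤K : r ≤ K
  r≤K = s≤s⁻¹ (m%n<n N (suc K))
  open PX.Automorphisms.Cover N K 4≤N 1≤K p r (trans N≡ (+-comm r _)) r≤K

  small : ∀ S → length S ≡ 2 + suc p → classSize (suc N) (suc K) 2 (colorOf S) (suc zero) ≤ ceilDiv (suc N) (suc K) + 1
  small S len = begin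
      classSize (suc N) (suc K) 2 (colorOf S) (suc zero)  ≤⟨ classSize-colorOf S ⟩
      length S                                            ≡⟨ len ⟩
      suc (suc (suc p))                                   ≡⟨ +-comm 1 _ ⟩
      suc (suc p) + 1                                     ≡⟨ cong (_+ 1) ceil≡ ⟨
      ceilDiv (suc N) (suc K) + 1                         ∎
    where open ≤-Reasoning

  choose : r < K ⊎ r ≡ K → _
  choose (inj₁ r<K) = colorOf twins , rigid⇒distinguishing twins (twins-rigid r<K) ,
    small twins (cong (2 +_) (length-applyUpTo (λ j → site j , zeros) (suc p)))
  choose (inj₂ r≡K) = colorOf edge , rigid⇒distinguishing edge (edge-rigid r≡K) ,
    small edge (cong (2 +_) (length-applyUpTo (λ j → site j , ones) (suc p)))

theorem6p2 : (n k : ℕ) → 5 ≤ n → 2 ≤ k → k < n →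
    DistIs n k 2 × Σ ℕ (λ r → RhoIs n k r × ceilDiv n k ≤ r × r ≤ ceilDiv n k + 1)
theorem6p2 (suc N) (suc K) (s≤s 4≤N) (s≤s 1≤K) (s≤s k≤N)
  with few-vertices N K 4≤N 1≤K k≤N
... | c₀ , dist₀ , small = ((c₀ , dist₀) , fewer-colors) , rho (distinguishing-size? m)
  where
  open Flips N K
  m = ceilDiv (suc N) (suc K)
  size = classSize (suc N) (suc K) 2

  fewer-colors : ∀ d′ → d′ < 2 → ¬ HasDistColoring (suc N) (suc K) d′
  fewer-colors zero _ (c , _) with () ← c (zero , replicate _ false)
  -- Every automorphism preserves a single colour, and a flip is not the identity.
  fewer-colors (suc zero) _ (c , dist) = flip-≢ zero (replicate _ false)
    (dist (flipAutomorphism zero) (λ v → one-color (c (flip zero v)) (c v)) _)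
    where
    one-color : ∀ (a b : Fin 1) → a ≡ b
    one-color zero zero = refl
  fewer-colors (suc (suc _)) (s≤s (s≤s ()))

  lower : ∀ c → Distinguishing (suc N) (suc K) 2 c → ∀ i → m ≤ size c i
  lower c dist i = ceilDiv-≤ (class-covers c dist i)

  rho : Dec (Σ (Vertex (suc N) (suc K) → Fin 2) λ c → Distinguishing (suc N) (suc K) 2 c × Σ (Fin 2) λ i → size c i ≡ m) →
        Σ ℕ (λ r → RhoIs (suc N) (suc K) r × m ≤ r × r ≤ m + 1)
  rho (yes found) = m , (found , lower) , ≤-refl , m≤m+n m 1
  -- If size `m` is not attained, the lower bound is strict for every class, so the class already
  -- constructed, of size at most `m + 1`, has exactly that size.
  rho (no none) = m + 1 ,
    ((c₀ , dist₀ , suc zero , ≤-antisym small (above c₀ dist₀ (suc zero))) , above) , m≤m+n m 1 , ≤-refl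
    where
    above : ∀ c → Distinguishing (suc N) (suc K) 2 c → ∀ i → m + 1 ≤ size c i
    above c dist i = subst (_≤ size c i) (+-comm 1 m)
      (≤∧≢⇒< (lower c dist i) (λ eq → none (c , dist , i , sym eq)))
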